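{- Let $\Gamma$ be a planning context, let $P, Q$ be ground states and $f$ a plan such that $\Gamma \vdash \{P\} \leadsto \{Q\} \mid f$ is derivable by the rules of the PCP logic. Then for every world $w \in \langle w_P\rangle$ and every action handler $\delta$ that is well-formed (with respect to $\Gamma$), we have $[\![f]\!]^{\delta}\, w \in \langle w_Q\rangle$.
   Context: **Syntax.** Fix a set of predicate symbols $R$ with arities, a set $X$ of variables, a set $C$ of constants, and a set of action names $\alpha$ (with arities). A term is a variable or a constant. An atom is $A ::= R(t_1,\dots,t_n)$ with $t_i$ terms. A constraint is $t = t'$ or $t \neq t'$ with $t,t'$ terms; a constraint list $\phi$ is a finite list of constraints. An action is an action name applied to terms, $a ::= \alpha(t_1,\dots,t_n)$. Plans are given by $f ::= \mathit{shrink} \mid a \mid f;f_1$ (the actions in plans are ground). Polarities are $z \in \{+,-\}$. A state is a finite list of formula maps: $P ::= \mathit{emp} \mid A\mapsto z \mid P*Q$, where $*$ is list concatenation with unit $\mathit{emp}$. Write $A \mapsto z\in P$ for list membership, and $A\notin P$ if neither $A\mapsto +$ nor $A\mapsto -$ is in $P$. $\mathit{emp}$ is valid, and $A\mapsto z * P$ is valid iff $A \notin P$ and $P$ is valid. "Ground" means containing no variables. $[\sigma]$ denotes application of a ground substitution $\sigma$ (a map from variables to constants, defined on all variables concerned). **Context.** A planning context $\Gamma$ is a set of action descriptions $\phi(\overline x);\{P(\overline x)\}\leadsto\{Q(\overline x)\}\mid \alpha(\overline x)$, where $\overline x$ is a list of distinct variables, all variables of $\phi,P,Q$ are among $\overline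 x$, and each action name $\alpha$ has at most one description in $\Gamma$. **Constraint normalisation.** $\mathit{norm}\,[]=\top$; $\mathit{norm}(t=t_1::\phi)$ is $\mathit{norm}\,\phi$ if $t,t_1$ are syntactically equal and $\bot$ otherwise; $\mathit{norm}(t\ne t_1::\phi)$ is $\bot$ if $t,t_1$ are syntactically equal and $\mathit{norm}\,\phi$ otherwise. "$\phi$ normalises to $\top$" means $\mathit{norm}\,\phi=\top$. **Subtyping** $<:$ on states is inductively defined by: $S <: \mathit{emp}$; and if $S' <: S$ and $A\mapsto z\in S'$ then $S' <: A\mapsto z * S$. **Override.** $P\sqcup \mathit{emp}=P$; $P\sqcup(A\mapsto z * Q) = (A\mapsto z * (P\setminus\{A\mapsto +, A\mapsto -\}))\sqcup Q$, where $P\setminus\{\dots\}$ removes all occurrences of the listed maps. **Rules of the PCP logic** (deriving $\Gamma\vdash\{P\}\leadsto\{Q\}\mid f$ with $P,Q$ ground; all states occurring in rules must be valid): - ApplyAction: if $\phi(\overline x);\{P(\overline x)\}\leadsto\{Q(\overline x)\}\mid\alpha(\overline x)\in\Gamma$, $\sigma$ is a ground substitution and $\phi(\overline x)[\sigma]$ normalises to $\top$, then $\Gamma\vdash\{P(\overline x)[\sigma]\}\leadsto\{Q(\overline x)[\sigma]\}\mid\alpha(\overline x)[\sigma]$. - Frame: if $\Gamma\vdash\{P\}\leadsto\{Q\}\mid a$ with $a$ a single action, and $A\notin P$, $A\notin Q$, then $\Gamma\vdash\{P*A\mapsto z\}\leadsto\{Q*A\mapsto z\}\mid a$. - Weakening: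 if $P'<:P$ and $\Gamma\vdash\{P\}\leadsto\{Q\}\mid f$ then $\Gamma\vdash\{P'\}\leadsto\{Q\}\mid f$. - Shrink: if $Q<:Q'$ and $\Gamma\vdash\{P\}\leadsto\{Q\}\mid f$ then $\Gamma\vdash\{P\}\leadsto\{Q'\}\mid f;\mathit{shrink}$. - Composition: if $Q<:Q'$, $\Gamma\vdash\{P\}\leadsto\{Q\}\mid f$ and $\Gamma\vdash\{Q'\}\leadsto\{R\}\mid f_1$ then $\Gamma\vdash\{P\}\leadsto\{R\}\mid f;f_1$. **Worlds.** A world $w$ is a set of ground atoms. For a ground state $S$, $\langle w_S\rangle$ is the set of worlds $w$ (well-formed worlds for $S$) that contain every $A$ with $A\mapsto +\in S$ and contain no $A$ with $A\mapsto -\in S$. **Action handlers and evaluation.** An action handler $\delta$ is a function taking a ground action and a world to a world. Evaluation of plans: $[\![\mathit{shrink}]\!]^\delta w = w$; $[\![a]\!]^\delta w=\delta\,a\,w$; $[\![f;f_1]\!]^\delta w=[\![f_1]\!]^\delta([\![f]\!]^\delta w)$. $\delta$ is well-formed (with respect to $\Gamma$) if for every $\phi(\overline x);\{P'(\overline x)\}\leadsto\{Q(\overline x)\}\mid\alpha(\overline x)\in\Gamma$, every ground substitution $\sigma$ such that $\phi(\overline x)[\sigma]$ normalises to $\top$, every ground state $P$ with $P<:P'(\overline x)[\sigma]$ (all states $P$, $P'(\overline x)[\sigma]$, $Q(\overline x)[\sigma]$ being valid), and every $w\in\langle w_P\rangle$, we have $\delta\,(\alpha(\overline x)[\sigma])\,w\in\langle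 w_{P\sqcup Q(\overline x)[\sigma]}\rangle$. -}

module Defs where

open import Data.Bool.Base using (Bool; true; false; if_then_else_)
open import Data.Empty using (⊥)
open import Data.Irrelevant using ([_])
open import Data.List.Base using (List; []; _∷_; _++_; filter; map)
import Data.List.Membership.DecPropositional as DecMembership
open import Data.List.Membership.Propositional using (_∈_; _∉_)
open import Data.Nat.Base using (ℕ)
open import Data.Product.Base using (_×_)
open import Data.Refinement.Base using (Refinement-syntax; _,_)
open import Data.Vec.Base as Vec using (Vec; lookup; tabulate)
import Data.Vec.Membership.Propositional as Vec
open import Data.Vec.Membership.Propositional.Properties using (∈-lookup)
open import Data.Vec.Properties using (≡-dec)
open import Data.Vec.Relation.Unary.Unique.Propositional using (Unique)
open import Level using (0ℓ)
open import Relation.Binary.Definitions using (DecidableEquality)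
open import Relation.Binary.PropositionalEquality using (_≡_; refl)
open import Relation.Nullary.Decidable using (yes; no; does; ¬?)
open import Relation.Unary using (Pred)
import Relation.Unary as U

record Signature : Set₁ where
  field
    PredSym     : Set
    predArity   : PredSym → ℕ
    Variable    : Set
    Constant    : Set
    ActionName  : Set
    actionArity : ActionName → ℕ
    -- Syntactic equality of terms and atoms has to be computed by
    -- normalisation and by override.
    _≟ᴾ_        : DecidableEquality PredSym
    _≟ᶜ_        : DecidableEquality Constant

data Polarity : Set where
  + - : Polarity

_≟ᶻ_ : DecidableEquality Polarity
+ ≟ᶻ + = yes refl
+ ≟ᶻ - = no λ ()
- ≟ᶻ + = no λ ()
- ≟ᶻ - = yes refl

module PCP (Sig : Signature) where
  open Signature Sig

  infix  7 _⟨_⟩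
  infix  6 _↦_
  infix  6 _≈_ _≉_
  infixr 5 _⨾_
  infix  4 _∈⟨w_⟩
  infix  3 _⊢⟨_⟩↝⟨_⟩∣_

  -- The syntax is indexed by the type V of variables that may occur in it;
  -- ground syntax is the case V = ⊥.

  data Term (V : Set) : Set where
    var : V → Term V
    con : Constant → Term V

  data Atom (V : Set) : Set where
    _⟨_⟩ : (R : PredSym) → Vec (Term V) (predArity R) → Atom V

  data Constraint (V : Set) : Set where
    _≈_ _≉_ : Term V → Term V → Constraint V

  data Action (V : Set) : Set where
    _⟨_⟩ : (α : ActionName) → Vec (Term V) (actionArity α) → Action V

  data FormulaMap (V : Set) : Set where
    _↦_ : Atom V → Polarity → FormulaMap V

  -- emp is [] and P * Q is P ++ Q.
  State : Set → Set
  State V = List (FormulaMap V)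

  GroundAtom GroundAction GroundState : Set
  GroundAtom   = Atom ⊥
  GroundAction = Action ⊥
  GroundState  = State ⊥

  data Plan : Set where
    shrink : Plan
    act    : GroundAction → Plan
    _⨾_    : Plan → Plan → Plan

  module _ {V : Set} where

    infix 4 _∉ᴬ_ _<:_

    _∉ᴬ_ : Atom V → State V → Set
    A ∉ᴬ P = (A ↦ + ∉ P) × (A ↦ - ∉ P)

    data Valid : State V → Set where
      emp : Valid []
      _∷_ : ∀ {A z P} → A ∉ᴬ P → Valid P → Valid (A ↦ z ∷ P)

    data _<:_ (S′ : State V) : State V → Set where
      emp : S′ <: []
      _∷_ : ∀ {A z S} → A ↦ z ∈ S′ → S′ <: S → S′ <: A ↦ z ∷ S

  module DecidableSyntax {V : Set} (_≟ⱽ_ : DecidableEquality V) where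

    infix  4 _≟ᵗ_ _≟ᴬ_ _≟ᵐ_
    infixl 5 _∖_ _⊔_

    _≟ᵗ_ : DecidableEquality (Term V)
    var x ≟ᵗ var y with x ≟ⱽ y
    ... | yes refl = yes refl
    ... | no  x≢y  = no λ where refl → x≢y refl
    var x ≟ᵗ con d = no λ ()
    con c ≟ᵗ var y = no λ ()
    con c ≟ᵗ con d with c ≟ᶜ d
    ... | yes refl = yes refl
    ... | no  c≢d  = no λ where refl → c≢d refl

    _≟ᴬ_ : DecidableEquality (Atom V)
    (R ⟨ ts ⟩) ≟ᴬ (R′ ⟨ us ⟩) with R ≟ᴾ R′
    ... | no  R≢R′ = no λ where refl → R≢R′ refl
    ... | yes refl with ≡-dec _≟ᵗ_ ts us
    ...   | yes refl  = yes refl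
    ...   | no  ts≢us = no λ where refl → ts≢us refl

    _≟ᵐ_ : DecidableEquality (FormulaMap V)
    (A ↦ z) ≟ᵐ (B ↦ z′) with A ≟ᴬ B | z ≟ᶻ z′
    ... | yes refl | yes refl = yes refl
    ... | no  A≢B  | _        = no λ where refl → A≢B refl
    ... | yes _    | no  z≢z′ = no λ where refl → z≢z′ refl

    -- true and false stand for ⊤ and ⊥.
    norm : List (Constraint V) → Bool
    norm []           = true
    norm (t ≈ t₁ ∷ φ) = if does (t ≟ᵗ t₁) then norm φ else false
    norm (t ≉ t₁ ∷ φ) = if does (t ≟ᵗ t₁) then false else norm φ

    open DecMembership _≟ᵐ_ using (_∈?_)

    _∖_ : State V → List (FormulaMap V) → State V
    P ∖ ms = filter (λ m → ¬? (m ∈? ms)) P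

    _⊔_ : State V → State V → State V
    P ⊔ []          = P
    P ⊔ (A ↦ z ∷ Q) = (A ↦ z ∷ (P ∖ (A ↦ + ∷ A ↦ - ∷ []))) ⊔ Q

  open DecidableSyntax {⊥} (λ ()) public using ()
    renaming (norm to normᵍ; _⊔_ to infixl 5 _⊔ᵍ_)

  GroundSubst : Set → Set
  GroundSubst V = V → Constant

  module _ {V : Set} where

    infixl 8 _[_]ᵗ _[_]ᴬ _[_]ᵐ _[_]ˢ _[_]ᵏ _[_]ᶜ _[_]ᵃ

    _[_]ᵗ : Term V → GroundSubst V → Term ⊥
    var x [ σ ]ᵗ = con (σ x)
    con c [ σ ]ᵗ = con c

    _[_]ᴬ : Atom V → GroundSubst V → GroundAtom
    (R ⟨ ts ⟩) [ σ ]ᴬ = R ⟨ Vec.map (_[ σ ]ᵗ) ts ⟩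

    _[_]ᵐ : FormulaMap V → GroundSubst V → FormulaMap ⊥
    (A ↦ z) [ σ ]ᵐ = A [ σ ]ᴬ ↦ z

    _[_]ˢ : State V → GroundSubst V → GroundState
    P [ σ ]ˢ = map (_[ σ ]ᵐ) P

    _[_]ᵏ : Constraint V → GroundSubst V → Constraint ⊥
    (t ≈ t₁) [ σ ]ᵏ = t [ σ ]ᵗ ≈ t₁ [ σ ]ᵗ
    (t ≉ t₁) [ σ ]ᵏ = t [ σ ]ᵗ ≉ t₁ [ σ ]ᵗ

    _[_]ᶜ : List (Constraint V) → GroundSubst V → List (Constraint ⊥)
    φ [ σ ]ᶜ = map (_[ σ ]ᵏ) φ

    _[_]ᵃ : Action V → GroundSubst V → GroundAction
    (α ⟨ ts ⟩) [ σ ]ᵃ = α ⟨ Vec.map (_[ σ ]ᵗ) ts ⟩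

  -- The variables among xs. A ground substitution for this type is defined
  -- on xs only, so that one exists also when xs is empty and there are no
  -- constants. The membership proof is irrelevant.
  VarIn : ∀ {n} → Vec Variable n → Set
  VarIn xs = [ x ∈ Variable ∣ x Vec.∈ xs ]

  record Description : Set where
    field
      name      : ActionName
      params    : Vec Variable (actionArity name)
      .distinct : Unique params
      φ         : List (Constraint (VarIn params))
      pre post  : State (VarIn params)

    action : Action (VarIn params)
    action = name ⟨ tabulate (λ i → var (lookup params i , [ ∈-lookup i params ])) ⟩

  record PlanningContext : Set₁ where
    field
      descriptions : Pred Description 0ℓ
      functional   : ∀ {d d′} → d U.∈ descriptions → d′ U.∈ descriptions →
                     Description.name d ≡ Description.name d′ → d ≡ d′

  open PlanningContext
  open Description

  -- Validity is required of every state that is not already the pre- or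
  -- postcondition of a premise.
  data _⊢⟨_⟩↝⟨_⟩∣_ (Γ : PlanningContext) :
       GroundState → GroundState → Plan → Set where

    applyAction : ∀ (d : Description) (σ : GroundSubst (VarIn (params d))) →
      d U.∈ descriptions Γ →
      normᵍ (φ d [ σ ]ᶜ) ≡ true →
      Valid (pre d [ σ ]ˢ) → Valid (post d [ σ ]ˢ) →
      Γ ⊢⟨ pre d [ σ ]ˢ ⟩↝⟨ post d [ σ ]ˢ ⟩∣ act (action d [ σ ]ᵃ)

    frame : ∀ {P Q a} (A : GroundAtom) (z : Polarity) →
      A ∉ᴬ P → A ∉ᴬ Q →
      Valid (P ++ A ↦ z ∷ []) → Valid (Q ++ A ↦ z ∷ []) →
      Γ ⊢⟨ P ⟩↝⟨ Q ⟩∣ act a →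
      Γ ⊢⟨ P ++ A ↦ z ∷ [] ⟩↝⟨ Q ++ A ↦ z ∷ [] ⟩∣ act a

    weakening : ∀ {P P′ Q f} →
      Valid P′ → P′ <: P →
      Γ ⊢⟨ P ⟩↝⟨ Q ⟩∣ f →
      Γ ⊢⟨ P′ ⟩↝⟨ Q ⟩∣ f

    shrink : ∀ {P Q Q′ f} →
      Valid Q′ → Q <: Q′ →
      Γ ⊢⟨ P ⟩↝⟨ Q ⟩∣ f →
      Γ ⊢⟨ P ⟩↝⟨ Q′ ⟩∣ f ⨾ shrink

    composition : ∀ {P Q Q′ R f f₁} →
      Q <: Q′ →
      Γ ⊢⟨ P ⟩↝⟨ Q ⟩∣ f →
      Γ ⊢⟨ Q′ ⟩↝⟨ R ⟩∣ f₁ →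
      Γ ⊢⟨ P ⟩↝⟨ R ⟩∣ f ⨾ f₁

  World : Set₁
  World = Pred GroundAtom 0ℓ

  _∈⟨w_⟩ : World → GroundState → Set
  w ∈⟨w S ⟩ = (∀ A → A ↦ + ∈ S → A U.∈ w) × (∀ A → A ↦ - ∈ S → A U.∉ w)

  ActionHandler : Set₁
  ActionHandler = GroundAction → World → World

  ⟦_⟧ : Plan → ActionHandler → World → World
  ⟦ shrink ⟧ δ w = w
  ⟦ act a  ⟧ δ w = δ a w
  ⟦ f ⨾ f₁ ⟧ δ w = ⟦ f₁ ⟧ δ (⟦ f ⟧ δ w)

  WellFormed : PlanningContext → ActionHandler → Set₁
  WellFormed Γ δ =
    ∀ (d : Description) (σ : GroundSubst (VarIn (params d))) (P : GroundState) (w : World) →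
    d U.∈ descriptions Γ →
    normᵍ (φ d [ σ ]ᶜ) ≡ true →
    Valid P → Valid (pre d [ σ ]ˢ) → Valid (post d [ σ ]ˢ) →
    P <: pre d [ σ ]ˢ →
    w ∈⟨w P ⟩ →
    δ (action d [ σ ]ᵃ) w ∈⟨w P ⊔ᵍ post d [ σ ]ˢ ⟩

{-# OPTIONS --safe #-}
-- The only delicate rule is Frame, since a handler is constrained only on
-- instances of descriptions. A derivation for a single action a is therefore
-- traced back to the instance {P₀} ↝ {Q₀} of the description of a that it
-- started from: P contains P₀, Q contains Q₀, and every map of Q is either in
-- Q₀ or a map of P whose atom does not occur in Q₀. So Q is contained in
-- P ⊔ Q₀, which is what well-formedness gives when applied to P itself.
module Submission where

open import Defs
open import Data.Bool.Base using (true)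
open import Data.List.Base using ([]; _∷_; _++_)
open import Data.List.Membership.Propositional using (_∈_; _∉_)
open import Data.List.Membership.Propositional.Properties
  using (∈-filter⁺; ∈-++⁺ˡ; ∈-++⁺ʳ; ∈-++⁻)
open import Data.List.Relation.Binary.Subset.Propositional using (_⊆_)
open import Data.List.Relation.Unary.Any using (here; there)
open import Data.Product.Base using (_×_; _,_)
open import Data.Sum.Base using (_⊎_; inj₁; inj₂; [_,_]′)
import Data.Sum.Base as Sum
open import Function.Base using (_∘_; id)
open import Relation.Binary.Definitions using (DecidableEquality)
open import Relation.Binary.PropositionalEquality using (_≡_; refl)
import Relation.Unary as U

module Soundness (Sig : Signature) where
  open PCP Sig
  open PlanningContext
  open Description

  module _ {V : Set} where

    <:⇒⊇ : {S′ S : State V} → S′ <: S → S ⊆ S′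
    <:⇒⊇ (m∈S′ ∷ S′<:S) (here refl) = m∈S′
    <:⇒⊇ (m∈S′ ∷ S′<:S) (there m∈S) = <:⇒⊇ S′<:S m∈S

    ⊇⇒<: : {S′ S : State V} → S ⊆ S′ → S′ <: S
    ⊇⇒<: {S = []}        S⊆S′ = emp
    ⊇⇒<: {S = A ↦ z ∷ S} S⊆S′ = S⊆S′ (here refl) ∷ ⊇⇒<: (S⊆S′ ∘ there)

    ∉ᴬ⇒∉ : ∀ {A : Atom V} {P} z → A ∉ᴬ P → A ↦ z ∉ P
    ∉ᴬ⇒∉ + (A+∉P , A-∉P) = A+∉P
    ∉ᴬ⇒∉ - (A+∉P , A-∉P) = A-∉P

    ∉ᴬ-⊆ : ∀ {A : Atom V} {P Q} → P ⊆ Q → A ∉ᴬ Q → A ∉ᴬ P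
    ∉ᴬ-⊆ P⊆Q (A+∉Q , A-∉Q) = A+∉Q ∘ P⊆Q , A-∉Q ∘ P⊆Q

    -- The list on the right is what one override step deletes, so this shows that a map on `A`
    -- passes its filter.
    ∉ᴬ⇒∉-both-signs : ∀ {A B : Atom V} {z z′ Q} → A ∉ᴬ B ↦ z ∷ Q →
                      A ↦ z′ ∉ B ↦ + ∷ B ↦ - ∷ []
    -- Once `A` is `B`, the head `B ↦ z` itself contradicts `A∉`, whatever `z′` is.
    ∉ᴬ⇒∉-both-signs {z = z} A∉ (here refl)         = ∉ᴬ⇒∉ z A∉ (here refl)
    ∉ᴬ⇒∉-both-signs {z = z} A∉ (there (here refl)) = ∉ᴬ⇒∉ z A∉ (here refl)

  module _ {V : Set} {_≟ⱽ_ : DecidableEquality V} where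
    open DecidableSyntax _≟ⱽ_

    ∈-⊔⁺ˡ : ∀ {A z P} Q → A ↦ z ∈ P → A ∉ᴬ Q → A ↦ z ∈ P ⊔ Q
    ∈-⊔⁺ˡ []           A∈P A∉Q = A∈P
    ∈-⊔⁺ˡ (B ↦ z′ ∷ Q) A∈P A∉Q =
      ∈-⊔⁺ˡ Q (there (∈-filter⁺ _ A∈P (∉ᴬ⇒∉-both-signs A∉Q))) (∉ᴬ-⊆ there A∉Q)

    -- Validity ensures that no later map of `Q` has the same atom, so a map once inserted is never
    -- deleted again.
    ∈-⊔⁺ʳ : ∀ {m P Q} → Valid Q → m ∈ Q → m ∈ P ⊔ Q
    ∈-⊔⁺ʳ (_∷_ {P = Q} A∉Q valid) (here refl) = ∈-⊔⁺ˡ Q (here refl) A∉Q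
    ∈-⊔⁺ʳ (A∉Q ∷ valid)           (there m∈Q) = ∈-⊔⁺ʳ valid m∈Q

  ∈⟨w⟩-antitone : ∀ {w : World} {P Q} → Q ⊆ P → w ∈⟨w P ⟩ → w ∈⟨w Q ⟩
  ∈⟨w⟩-antitone Q⊆P (pos , neg) =
    (λ A → pos A ∘ Q⊆P) , (λ A → neg A ∘ Q⊆P)

  -- The action is an index, so that matching turns it into the instance `action d [ σ ]ᵃ` about
  -- which `WellFormed` speaks.
  data Origin (Γ : PlanningContext) (P Q : GroundState) : GroundAction → Set where
    origin : (d : Description) (σ : GroundSubst (VarIn (params d))) →
      d U.∈ descriptions Γ →
      normᵍ (φ d [ σ ]ᶜ) ≡ true →
      Valid P → Valid (pre d [ σ ]ˢ) → Valid (post d [ σ ]ˢ) →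
      pre d [ σ ]ˢ ⊆ P →
      post d [ σ ]ˢ ⊆ Q →
      (∀ {A z} → A ↦ z ∈ Q →
        A ↦ z ∈ post d [ σ ]ˢ ⊎ (A ↦ z ∈ P × A ∉ᴬ post d [ σ ]ˢ)) →
      Origin Γ P Q (action d [ σ ]ᵃ)

  -- Induction on the derivation; the plans concluded by `shrink` and `composition` are sequences,
  -- so these rules cannot occur.
  ⊢act⇒Origin : ∀ {Γ P Q a} → Γ ⊢⟨ P ⟩↝⟨ Q ⟩∣ act a → Origin Γ P Q a
  ⊢act⇒Origin (applyAction d σ d∈Γ norm≡⊤ vpre vpost) =
    origin d σ d∈Γ norm≡⊤ vpre vpre vpost id id inj₁
  ⊢act⇒Origin (weakening vP′ P′<:P D) with ⊢act⇒Origin D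
  ... | origin d σ d∈Γ norm≡⊤ vP vpre vpost pre⊆P post⊆Q split =
    origin d σ d∈Γ norm≡⊤ vP′ vpre vpost (<:⇒⊇ P′<:P ∘ pre⊆P) post⊆Q
      (Sum.map₂ (λ (A∈P , A∉post) → <:⇒⊇ P′<:P A∈P , A∉post) ∘ split)
  ⊢act⇒Origin (frame {P} {Q} A z A∉P A∉Q vPA vQA D) with ⊢act⇒Origin D
  ... | origin d σ d∈Γ norm≡⊤ vP vpre vpost pre⊆P post⊆Q split =
    origin d σ d∈Γ norm≡⊤ vPA vpre vpost (∈-++⁺ˡ ∘ pre⊆P) (∈-++⁺ˡ ∘ post⊆Q) split′
    where
    split′ : ∀ {B z′} → B ↦ z′ ∈ Q ++ A ↦ z ∷ [] →
      B ↦ z′ ∈ post d [ σ ]ˢ ⊎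
      (B ↦ z′ ∈ P ++ A ↦ z ∷ [] × B ∉ᴬ post d [ σ ]ˢ)
    split′ B∈ with ∈-++⁻ Q B∈
    ... | inj₁ B∈Q         = Sum.map₂ (λ (B∈P , B∉post) → ∈-++⁺ˡ B∈P , B∉post) (split B∈Q)
    -- The side condition of Frame on `Q` passes to the postcondition of the instance, so override
    -- leaves the framed map in place.
    ... | inj₂ (here refl) = inj₂ (∈-++⁺ʳ P (here refl) , ∉ᴬ-⊆ post⊆Q A∉Q)

  module _ {Γ : PlanningContext} {δ : ActionHandler} (wf : WellFormed Γ δ) where

    act-sound : ∀ {P Q a w} → Origin Γ P Q a → w ∈⟨w P ⟩ → δ a w ∈⟨w Q ⟩
    act-sound {P} {Q} {w = w}
      (origin d σ d∈Γ norm≡⊤ vP vpre vpost pre⊆P post⊆Q split) w∈P =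
      ∈⟨w⟩-antitone Q⊆P⊔post
        (wf d σ P w d∈Γ norm≡⊤ vP vpre vpost (⊇⇒<: pre⊆P) w∈P)
      where
      Q⊆P⊔post : Q ⊆ P ⊔ᵍ post d [ σ ]ˢ
      Q⊆P⊔post {A ↦ z} A∈Q =
        [ ∈-⊔⁺ʳ vpost
        , (λ (A∈P , A∉post) → ∈-⊔⁺ˡ (post d [ σ ]ˢ) A∈P A∉post)
        ]′ (split A∈Q)

    -- For `frame` the induction hypothesis would say nothing about the framed atom after the
    -- action, hence the detour through `Origin`.
    sound : ∀ {P Q f w} → Γ ⊢⟨ P ⟩↝⟨ Q ⟩∣ f → w ∈⟨w P ⟩ → ⟦ f ⟧ δ w ∈⟨w Q ⟩
    sound D@(applyAction _ _ _ _ _ _) = act-sound (⊢act⇒Origin D)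
    sound D@(frame _ _ _ _ _ _ _)     = act-sound (⊢act⇒Origin D)
    sound (weakening _ P′<:P D)       = sound D ∘ ∈⟨w⟩-antitone (<:⇒⊇ P′<:P)
    sound (shrink _ Q<:Q′ D)          = ∈⟨w⟩-antitone (<:⇒⊇ Q<:Q′) ∘ sound D
    sound (composition Q<:Q′ D D₁)    = sound D₁ ∘ ∈⟨w⟩-antitone (<:⇒⊇ Q<:Q′) ∘ sound D

theorem11 : (Sig : Signature) → let open PCP Sig in
    (Γ : PlanningContext) (P Q : GroundState) (f : Plan) →
    Γ ⊢⟨ P ⟩↝⟨ Q ⟩∣ f →
    (w : World) → w ∈⟨w P ⟩ →
    (δ : ActionHandler) → WellFormed Γ δ →
    ⟦ f ⟧ δ w ∈⟨w Q ⟩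
theorem11 Sig Γ P Q f D w w∈P δ wf = Soundness.sound Sig wf D w∈P
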